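{- Let $\kappa$ be a positive integer and let $\mathcal{C}_S,\mathcal{C}_T$ be legal configurations for capacity $\kappa$ with $|\mathcal{C}_S|=|\mathcal{C}_T|$ and with the same underlying multiset of items $U$. Suppose that every item in $U$ has size at most $\kappa/\alpha$ for some integer $\alpha>1$, and that the average slack of the bunches in $\mathcal{C}_S$ and in $\mathcal{C}_T$ is at least $$\frac{\kappa}{\alpha+1}+\frac{3\alpha\kappa}{(\alpha+1)|\mathcal{C}_S|}.$$ Then there is a reconfiguration sequence for capacity $\kappa$ from $\mathcal{C}_S$ to the FFD configuration $\mathcal{C}_{FFD}$ of $U$, there is one from $\mathcal{C}_T$ to $\mathcal{C}_{FFD}$, and hence there is one from $\mathcal{C}_S$ to $\mathcal{C}_T$.
   Context: Items are positive integers (items of the same size are indistinguishable). A bunch is a finite (possibly empty) multiset of items; $\mathrm{vol}(B)$ is the sum of its items and $\mathrm{slack}(B)=\kappa-\mathrm{vol}(B)$. A configuration is a finite multiset of bunches; $|\mathcal{C}|$ is the number of bunches counted with multiplicity (empty bunches included); its underlying multiset is the multiset union of the items of all its bunches. A configuration is legal for capacity $\kappa$ if every bunch has volume at most $\kappa$. The average slack of $\mathcal{C}$ is $\frac{1}{|\mathcal{C}|}\sum_{B\in\mathcal{C}}\mathrm{slack}(B)$. Two legal configurations $\mathcal{C},\mathcal{D}$ are adjacent if $\mathcal{D}$ is formed from $\mathcal{C}$ by the move of a single item: $\mathcal{C}\setminus\mathcal{D}$ consists of two bunches $B_d,B_r$, $\mathcal{D}\setminus\mathcal{C}$ consists of two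 bunches $B_d',B_r'$, and for some item $u$ in $B_d$, $B_d'$ is $B_d$ with one copy of $u$ removed and $B_r'$ is $B_r$ with one copy of $u$ added. A reconfiguration sequence for capacity $\kappa$ is a finite sequence of legal configurations for capacity $\kappa$ in which consecutive configurations are adjacent. The First-Fit-Decreasing (FFD) configuration $\mathcal{C}_{FFD}$ of $U$ is obtained by sorting the items of $U$ in non-increasing order of size and placing them one by one in the first bunch (in order of creation) with enough slack, opening a new bunch if no such bunch exists; it is regarded as a configuration with $|\mathcal{C}_S|$ bunches by adding empty bunches. -}

module Defs where

open import Data.Integer as ℤ using (ℤ; +_; _⊖_)
open import Data.List using (List; []; _∷_; _++_; map; foldr; foldl; length; replicate; filter)
import Data.List as List
open import Data.List.Membership.DecPropositional using () renaming (_∈?_ to mem?)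
open import Data.List.Membership.Propositional.Properties using (∈-∃++)
open import Data.List.Relation.Binary.Permutation.Propositional
  using (_↭_; ↭-refl; ↭-prep; ↭-sym; ↭-trans; ↭-setoid)
open import Data.List.Relation.Binary.Permutation.Propositional.Properties
  using (∈-resp-↭; drop-∷; shift; ¬x∷xs↭[])
import Data.List.Relation.Binary.Permutation.Setoid as SetoidPermutation
open import Data.List.Relation.Unary.All using (All)
open import Data.List.Relation.Unary.Any using (here)
import Data.List.Sort as Sort
open import Data.Nat using (ℕ; suc; _+_; _*_; _∸_; _≤_; NonZero)
open import Data.Nat.ListAction using (sum)
open import Data.Nat.Properties using (_≟_; ≤-decTotalOrder; m*n≢0)
open import Data.Product using (_×_; _,_; ∃-syntax)
open import Data.Rational as ℚ using (ℚ)
import Relation.Binary.Construct.Flip.EqAndOrd as Flip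
open import Relation.Binary using (Decidable)
open import Relation.Binary.PropositionalEquality using (_≡_; refl)
open import Relation.Nullary using (yes; no)

Item : Set
Item = ℕ

-- Bunches and configurations are finite multisets represented by lists: a
-- bunch is taken up to _↭_, and a configuration up to _≈_, which permutes the
-- bunches and also the items inside each bunch.
Bunch : Set
Bunch = List Item

Config : Set
Config = List Bunch

open SetoidPermutation (↭-setoid {A = Item}) public using () renaming (_↭_ to _≈_)

items : Config → List Item
items = List.concat

vol : Bunch → ℕ
vol = sum

slack : ℕ → Bunch → ℤ
slack κ B = κ ⊖ vol B

Legal : ℕ → Config → Set
Legal κ = All (λ B → vol B ≤ κ)

averageSlack : ℕ → (C : Config) → .{{NonZero (length C)}} → ℚ
averageSlack κ C = foldr ℤ._+_ ℤ.0ℤ (map (slack κ) C) ℚ./ length C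

slackBound : (κ α n : ℕ) → .{{NonZero n}} → ℚ
slackBound κ α n = (+ κ ℚ./ suc α) ℚ.+ (+ (3 * α * κ) ℚ./ (suc α * n))
  where instance _ = m*n≢0 (suc α) n

_↭?_ : Decidable (_↭_ {A = Item})
[]       ↭? []       = yes ↭-refl
[]       ↭? (y ∷ ys) = no λ p → ¬x∷xs↭[] (↭-sym p)
(x ∷ xs) ↭? ys with mem? _≟_ x ys
... | no x∉ys = no λ p → x∉ys (∈-resp-↭ p (here refl))
... | yes x∈ys with ∈-∃++ x∈ys
...   | as , bs , refl with xs ↭? (as ++ bs)
...     | yes p = yes (↭-trans (↭-prep x p) (↭-sym (shift x as bs)))
...     | no ¬p = no λ p → ¬p (drop-∷ (↭-trans p (shift x as bs)))

multiplicity : Bunch → Config → ℕ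
multiplicity B C = length (filter (B ↭?_) C)

-- X is the multiset difference C ∖ D; truncated subtraction is what makes
-- bunches common to C and D cancel.
_IsDifference_∖_ : Config → Config → Config → Set
X IsDifference C ∖ D = ∀ B → multiplicity B X ≡ multiplicity B C ∸ multiplicity B D

Adjacent : ℕ → Config → Config → Set
Adjacent κ C D =
  Legal κ C × Legal κ D ×
  ∃[ Bd ] ∃[ Br ] ∃[ Bd′ ] ∃[ Br′ ]
    (Bd ∷ Br ∷ []) IsDifference C ∖ D ×
    (Bd′ ∷ Br′ ∷ []) IsDifference D ∖ C ×
    ∃[ u ] Bd ↭ u ∷ Bd′ × Br′ ↭ u ∷ Br

-- Configurations are compared up to _≈_, so the last term of the sequence only
-- needs to represent the same configuration as the target.
data ReconfigurationSequence (κ : ℕ) : Config → Config → Set where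
  done : ∀ {C D} → Legal κ C → C ≈ D → ReconfigurationSequence κ C D
  move : ∀ {C D E} → Adjacent κ C D → ReconfigurationSequence κ D E →
         ReconfigurationSequence κ C E

open Sort (Flip.decTotalOrder ≤-decTotalOrder) public
  using () renaming (sort to sortNonIncreasing)

place : ℕ → Config → Item → Config
place κ []      u = (u ∷ []) ∷ []
place κ (B ∷ C) u with (+ u) ℤ.≤? slack κ B
... | yes _ = (u ∷ B) ∷ C
... | no  _ = B ∷ place κ C u

firstFit : ℕ → List Item → Config
firstFit κ = foldl (place κ) []

-- The result has n bunches only when C has at most n of them; otherwise it is
-- C itself, and no configuration with n bunches can be reconfigured to it.
padTo : ℕ → Config → Config
padTo n C = C ++ replicate (n ∸ length C) []

FFD : (κ n : ℕ) → List Item → Config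
FFD κ n U = padTo n (firstFit κ (sortNonIncreasing U))

{-# OPTIONS --safe #-}

-- Write V for the total volume. The hypothesis on the average slack says
-- (α+1) V + 3ακ ≤ ακ |C|, so that even after setting two bunches aside some
-- bunch is underfull: (α+1) vol B < ακ. Call x small when (α+1) x ≤ κ and large
-- otherwise. A small item fits into every underfull bunch; any item fits into an
-- underfull bunch holding large items only, as these are fewer than α. The
-- items are brought to their first-fit position in non-increasing order. To
-- place u in a bunch B, the unplaced items of B are first evicted: a small one
-- moves to any other underfull bunch, and for a large one an underfull bunch is
-- first cleared of its small items, none of which has been placed yet since
-- placed items are at least as large as unplaced ones. The same count shows
-- that first-fit never needs more than |C| bunches. Moves are reversible, which
-- gives the sequence from one configuration to another.
module Submission where

open import Defs
open import Data.Integer as ℤ using (+_; _⊖_; +≤+)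
import Data.Integer.Properties as ℤ
import Data.Integer.Tactic.RingSolver as ℤSolver
open import Data.List
  using (List; []; _∷_; _++_; length; map; concat; concatMap; filter; partition; foldl; foldr; replicate)
open import Data.List.Membership.Propositional using (_∈_; find; lose)
open import Data.List.Membership.Propositional.Properties using (∈-∃++; ∈-++⁻)
open import Data.List.Properties
  using (filter-++; filter-none; length-++; length-map; length-replicate; map-∘; map-id;
         ++-identityʳ)
open import Data.List.Relation.Binary.Permutation.Propositional
  using (_↭_; ↭-refl; ↭-sym; ↭-trans; ↭-prep; ↭-swap; ↭-reflexive; ↭-setoid; ↭-isEquivalence;
         ↭⇒↭ₛ′; ↭ₛ⇒↭)
open import Data.List.Relation.Binary.Permutation.Propositional.Properties
  using (↭-length; ↭-empty-inv; drop-∷; ++⁺ˡ; ++⁺ʳ; shift; shifts; map⁺; ∈-resp-↭; All-resp-↭)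
import Data.List.Relation.Binary.Permutation.Setoid as SetoidPermutation
import Data.List.Relation.Binary.Permutation.Setoid.Properties as SetoidProperties
open import Data.List.Relation.Unary.All as All using (All; []; _∷_)
open import Data.List.Relation.Unary.All.Properties
  using (¬Any⇒All¬; concat⁻; ++⁻ˡ; ++⁻ʳ; partition-All) renaming (++⁺ to All-++⁺)
open import Data.List.Relation.Unary.AllPairs using (AllPairs; []; _∷_)
open import Data.List.Relation.Unary.Any using (Any; here; there; any?)
open import Data.List.Relation.Unary.Sorted.TotalOrder.Properties using (Sorted⇒AllPairs)
import Data.List.Sort as Sort
open import Data.Nat as ℕ
  using (ℕ; zero; suc; _+_; _*_; _∸_; _<_; NonZero; z≤n; s≤s; _≤?_; _<?_)
open import Data.Nat.ListAction using (sum)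
open import Data.Nat.ListAction.Properties using (sum-++; sum-↭)
open import Data.Nat.Properties
  using (≤-reflexive; ≤-trans; <⇒≤; ≤-<-trans; <-≤-trans; ≮⇒≥; ≰⇒>; ≤-decTotalOrder;
         m≢1+n+m; m<m+n; m≤m+n; m≤n+m; m≤n*m; m*n≢0; m+n≤o⇒m≤o; m+n≤o⇒m≤o∸n;
         m+n∸m≡n; [m+n]∸[m+o]≡n∸o; 0∸n≡0;
         +-assoc; +-comm; +-mono-≤; +-mono-<-≤; +-monoˡ-≤; +-cancelˡ-≤; +-cancelʳ-≤; +-cancelˡ-<;
         *-zeroʳ; *-distribˡ-+; *-distribʳ-+; *-monoˡ-≤; *-monoʳ-≤;
         *-cancelˡ-≤; *-cancelˡ-<; *-cancelʳ-<; module ≤-Reasoning)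
open import Data.Nat.Tactic.RingSolver using (solve-∀)
open import Data.Product using (_×_; _,_; ∃-syntax; proj₁; proj₂; uncurry)
open import Data.Rational as ℚ using (_/_; _≤_)
import Data.Rational.Properties as ℚ
import Data.Rational.Unnormalised as ℚᵘ
import Data.Rational.Unnormalised.Properties as ℚᵘ
open import Data.Sum using (inj₁; inj₂)
open import Function using (_∘_)
open import Relation.Binary using (DecTotalOrder)
import Relation.Binary.Construct.Flip.EqAndOrd as Flip
open import Relation.Binary.PropositionalEquality
  using (_≡_; refl; sym; trans; cong; cong₂; subst; subst₂; setoid; module ≡-Reasoning)
open import Relation.Nullary using (¬_; yes; no; contradiction)

open SetoidPermutation (↭-setoid {A = Item}) using ()
  renaming (↭-refl to ≈-refl; ↭-sym to ≈-sym; ↭-trans to ≈-trans; prep to ≈-prep; swap to ≈-swap)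
module ≈ = SetoidProperties (↭-setoid {A = Item})

private variable
  κ : ℕ
  Bd Br Bd′ Br′ : Bunch
  C D E R X Y : Config
  u : Item

-- Reconfiguration sequences up to equality of multisets.

vol-resp-↭ : ∀ {B B′} → B ↭ B′ → vol B ℕ.≤ κ → vol B′ ℕ.≤ κ
vol-resp-↭ {κ} p = subst (ℕ._≤ κ) (sum-↭ p)

legal-resp-≈ : C ≈ D → Legal κ C → Legal κ D
legal-resp-≈ = ≈.All-resp-↭ vol-resp-↭

multiplicity-resp-≈ : ∀ B → C ≈ D → multiplicity B C ≡ multiplicity B D
multiplicity-resp-≈ B p = ≈.xs↭ys⇒|xs|≡|ys| (≈.filter⁺ (B ↭?_) (λ x↭y B↭x → ↭-trans B↭x x↭y) p)

multiplicity-++ : ∀ B X Y → multiplicity B (X ++ Y) ≡ multiplicity B X + multiplicity B Y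
multiplicity-++ B X Y = trans (cong length (filter-++ (B ↭?_) X Y)) (length-++ (filter (B ↭?_) X))

adjacent-respˡ-≈ : C ≈ D → Adjacent κ D E → Adjacent κ C E
adjacent-respˡ-≈ {E = E} p (lD , lE , Bd , Br , Bd′ , Br′ , d₁ , d₂ , mv) =
  legal-resp-≈ (≈-sym p) lD , lE , Bd , Br , Bd′ , Br′ ,
  (λ B → trans (d₁ B) (cong (_∸ multiplicity B E) (sym (multiplicity-resp-≈ B p)))) ,
  (λ B → trans (d₂ B) (cong (multiplicity B E ∸_) (sym (multiplicity-resp-≈ B p)))) , mv

adjacent-sym : Adjacent κ C D → Adjacent κ D C
adjacent-sym (lC , lD , Bd , Br , Bd′ , Br′ , d₁ , d₂ , u , p , q) =
  lD , lC , Br′ , Bd′ , Br , Bd ,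
  (λ B → trans (multiplicity-resp-≈ B (≈-swap ↭-refl ↭-refl ≈-refl)) (d₂ B)) ,
  (λ B → trans (multiplicity-resp-≈ B (≈-swap ↭-refl ↭-refl ≈-refl)) (d₁ B)) , u , q , p

-- `done` carries a permutation only at the end of a sequence. Absorbing one at the start is what
-- lets two sequences be joined.
reconf-respˡ-≈ : C ≈ D → ReconfigurationSequence κ D E → ReconfigurationSequence κ C E
reconf-respˡ-≈ p (done l q) = done (legal-resp-≈ (≈-sym p) l) (≈-trans p q)
reconf-respˡ-≈ p (move a s) = move (adjacent-respˡ-≈ p a) s

reconf-trans : ReconfigurationSequence κ C D → ReconfigurationSequence κ D E →
               ReconfigurationSequence κ C E
reconf-trans (done _ p) t = reconf-respˡ-≈ p t
reconf-trans (move a s) t = move a (reconf-trans s t)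

reconf-sym : ReconfigurationSequence κ C D → ReconfigurationSequence κ D C
reconf-sym (done l p) = done (legal-resp-≈ p l) (≈-sym p)
reconf-sym (move a@(l , _) s) = reconf-trans (reconf-sym s) (move (adjacent-sym a) (done l ≈-refl))

reconf-legalʳ : ReconfigurationSequence κ C D → Legal κ D
reconf-legalʳ (done l p) = legal-resp-≈ p l
reconf-legalʳ (move _ s) = reconf-legalʳ s

-- Moves of a single item as multiset differences.

Apart : Config → Config → Set
Apart X Y = All (λ x → All (λ y → ¬ (x ↭ y)) Y) X

-- The common part `R` cancels in the truncated subtraction. No bunch occurs in both `X` and `Y`, so
-- for each `B` one of the two remaining multiplicities is zero, and subtracting that of `Y` leaves
-- that of `X`.
apart-difference : Apart X Y → C ≈ X ++ R → D ≈ Y ++ R → X IsDifference C ∖ D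
apart-difference {X} {Y} {C} {R} {D} apart p q B = sym (begin
  multiplicity B C ∸ multiplicity B D
    ≡⟨ cong₂ _∸_ (count p) (count q) ⟩
  (multiplicity B R + multiplicity B X) ∸ (multiplicity B R + multiplicity B Y)
    ≡⟨ [m+n]∸[m+o]≡n∸o (multiplicity B R) _ _ ⟩
  multiplicity B X ∸ multiplicity B Y
    ≡⟨ monus ⟩
  multiplicity B X ∎)
  where
  open ≡-Reasoning
  count : ∀ {E Z} → E ≈ Z ++ R → multiplicity B E ≡ multiplicity B R + multiplicity B Z
  count {Z = Z} r = trans (multiplicity-resp-≈ B r)
                          (trans (multiplicity-++ B Z R) (+-comm (multiplicity B Z) _))
  absent : ∀ {Z} → All (λ z → ¬ (B ↭ z)) Z → multiplicity B Z ≡ 0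
  absent = cong length ∘ filter-none (B ↭?_)
  monus : multiplicity B X ∸ multiplicity B Y ≡ multiplicity B X
  monus with any? (B ↭?_) X
  ... | no ∉X = trans (cong (_∸ multiplicity B Y) (absent (¬Any⇒All¬ X ∉X)))
                      (trans (0∸n≡0 (multiplicity B Y)) (sym (absent (¬Any⇒All¬ X ∉X))))
  ... | yes ∈X = cong (multiplicity B X ∸_) (absent (All.lookupWith meet apart ∈X))
    where
    meet : ∀ {x} → All (λ y → ¬ (x ↭ y)) Y → B ↭ x → All (λ y → ¬ (B ↭ y)) Y
    meet ≁Y B↭x = All.map (λ x≁y B↭y → x≁y (↭-trans (↭-sym B↭x) B↭y)) ≁Y

-- When Bd′ ↭ Br the move merely exchanges the two bunches, and Adjacent, which
-- asks for multiset differences of size two, does not hold.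
reconf-move : Legal κ (Bd ∷ Br ∷ R) → vol Br′ ℕ.≤ κ → Bd ↭ u ∷ Bd′ → Br′ ↭ u ∷ Br →
              ReconfigurationSequence κ (Bd ∷ Br ∷ R) (Bd′ ∷ Br′ ∷ R)
reconf-move {κ} {Bd} {Br} {R} {Br′} {u} {Bd′} l@(ld ∷ _ ∷ lR) lr′ p q with Bd′ ↭? Br
... | yes e = done l (≈-trans (≈-prep (↭-trans p (↭-trans (↭-prep u e) (↭-sym q)))
                                      (≈-prep (↭-sym e) ≈-refl))
                              (≈-swap ↭-refl ↭-refl ≈-refl))
... | no ne = move (l , l′ , Bd , Br , Bd′ , Br′ ,
                    apart-difference apart ≈-refl ≈-refl ,
                    apart-difference apart′ ≈-refl ≈-refl , u , p , q)
                   (done l′ ≈-refl)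
  where
  longer : ∀ {v} {V W : Bunch} → V ↭ v ∷ W → ¬ (V ↭ W)
  longer {W = W} r s = m≢1+n+m (length W) {0} (trans (sym (↭-length s)) (↭-length r))
  drop : ∀ {V W : Bunch} → u ∷ V ↭ u ∷ W → V ↭ W
  drop = drop-∷
  l′ : Legal κ (Bd′ ∷ Br′ ∷ R)
  l′ = ℕ≤ ∷ lr′ ∷ lR
    where ℕ≤ = ≤-trans (m≤n+m (vol Bd′) u) (vol-resp-↭ p ld)
  -- Two of the four pairs differ in length. Equality in either of the other two would give
  -- `Bd′ ↭ Br`, in one case after cancelling `u`.
  apart : Apart (Bd ∷ Br ∷ []) (Bd′ ∷ Br′ ∷ [])
  apart = (longer p ∷ (λ r → ne (drop (↭-trans (↭-sym p) (↭-trans r q)))) ∷ []) ∷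
          ((λ r → ne (↭-sym r)) ∷ (λ r → longer q (↭-sym r)) ∷ []) ∷ []
  apart′ : Apart (Bd′ ∷ Br′ ∷ []) (Bd ∷ Br ∷ [])
  apart′ = ((λ r → longer p (↭-sym r)) ∷ (λ r → ne r) ∷ []) ∷
           ((λ r → ne (drop (↭-trans (↭-sym p) (↭-trans (↭-sym r) q)))) ∷ longer q ∷ []) ∷ []

-- Counting with the threshold `d / c`, cross-multiplied to stay in `ℕ`.

module _ (c d : ℕ) where

  sum-≤-length : ∀ {B} → All (λ x → c * x ℕ.≤ d) B → c * sum B ℕ.≤ length B * d
  sum-≤-length [] = ≤-reflexive (*-zeroʳ c)
  sum-≤-length {x ∷ B} (p ∷ ps) = begin
    c * (x + sum B)    ≡⟨ *-distribˡ-+ c x (sum B) ⟩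
    c * x + c * sum B  ≤⟨ +-mono-≤ p (sum-≤-length ps) ⟩
    d + length B * d   ∎
    where open ≤-Reasoning

  length-≤-sum : ∀ {B} → All (λ x → d ℕ.≤ c * x) B → length B * d ℕ.≤ c * sum B
  length-≤-sum [] = z≤n
  length-≤-sum {x ∷ B} (p ∷ ps) = begin
    d + length B * d   ≤⟨ +-mono-≤ p (length-≤-sum ps) ⟩
    c * x + c * sum B  ≡⟨ *-distribˡ-+ c x (sum B) ⟨
    c * (x + sum B)    ∎
    where open ≤-Reasoning

  -- Dropping a bunch that reaches the threshold takes at least `d` from the left side and exactly
  -- `d` from the right, so the strict inequality passes to the remaining bunches. It is absurd once
  -- none is left.
  pigeonhole : ∀ C → c * vol (items C) ℕ.< length C * d → Any (λ B → c * vol B ℕ.< d) C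
  pigeonhole [] p with () ← subst (ℕ._< 0) (*-zeroʳ c) p
  pigeonhole (B ∷ C) p with c * vol B <? d
  ... | yes q = here q
  ... | no ¬q = there (pigeonhole C (+-cancelˡ-< d _ _ (begin-strict
    d + c * vol (items C)          ≤⟨ +-monoˡ-≤ _ (≮⇒≥ ¬q) ⟩
    c * vol B + c * vol (items C)  ≡⟨ *-distribˡ-+ c (vol B) _ ⟨
    c * (vol B + vol (items C))    ≡⟨ cong (c *_) (sum-++ B (items C)) ⟨
    c * vol (B ++ items C)         <⟨ p ⟩
    d + length C * d               ∎)))
    where open ≤-Reasoning

-- Small and large items in underfull bunches.

module _ (κ α : ℕ) where

  Small Large Bounded : Item → Set
  Small x = suc α * x ℕ.≤ κ
  Large x = κ ℕ.< suc α * x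
  Bounded x = α * x ℕ.≤ κ

  -- Equivalently, the slack exceeds `κ / (α + 1)`, the size limit of a small item.
  Underfull : Bunch → Set
  Underfull B = suc α * vol B ℕ.< α * κ

  small-fits : ∀ {B x} → Underfull B → Small x → vol B + x ℕ.≤ κ
  small-fits {B} {x} B< x≤ = <⇒≤ (*-cancelˡ-< (suc α) _ _ (begin-strict
    suc α * (vol B + x)        ≡⟨ *-distribˡ-+ (suc α) (vol B) x ⟩
    suc α * vol B + suc α * x  <⟨ +-mono-<-≤ B< x≤ ⟩
    α * κ + κ                  ≡⟨ +-comm (α * κ) κ ⟩
    suc α * κ                  ∎))
    where open ≤-Reasoning

  -- An underfull bunch of large items has fewer than α of them, and any α
  -- bounded items fit together.
  bounded-fits : ∀ {B x} .{{_ : NonZero α}} → Underfull B → All Large B →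
                 All Bounded B → Bounded x → vol B + x ℕ.≤ κ
  bounded-fits {B} {x} B< large bounded x≤ = *-cancelˡ-≤ α (begin
    α * (vol B + x)      ≡⟨ *-distribˡ-+ α (vol B) x ⟩
    α * vol B + α * x    ≤⟨ +-mono-≤ (sum-≤-length α κ bounded) x≤ ⟩
    length B * κ + κ     ≡⟨ +-comm (length B * κ) κ ⟩
    suc (length B) * κ   ≤⟨ *-monoˡ-≤ κ few ⟩
    α * κ                ∎)
    where
    open ≤-Reasoning
    few : length B ℕ.< α
    -- Largeness is weakened to a non-strict bound, since the strict sum would fail for an empty
    -- bunch. The strictness comes from `B<`.
    few = *-cancelʳ-< κ _ _ (≤-<-trans (length-≤-sum (suc α) κ (All.map <⇒≤ large)) B<)

-- States with placed and unplaced items.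

concat-↭ : ∀ {A : Set} {xss yss : List (List A)} → xss ↭ yss → concat xss ↭ concat yss
concat-↭ _↭_.refl = ↭-refl
concat-↭ (_↭_.prep xs p) = ++⁺ˡ xs (concat-↭ p)
concat-↭ (_↭_.swap xs ys p) = ↭-trans (shifts xs ys) (++⁺ˡ ys (++⁺ˡ xs (concat-↭ p)))
concat-↭ (_↭_.trans p q) = ↭-trans (concat-↭ p) (concat-↭ q)

↭⇒≈ : ∀ {C D : Config} → C ↭ D → C ≈ D
↭⇒≈ = ↭⇒↭ₛ′ ↭-isEquivalence

-- A bunch is split into the items that already sit where first-fit puts them
-- and the items still to be placed.
State : Set
State = List (Bunch × Bunch)

contents : State → Config
contents = map (uncurry _++_)

placed : State → Config
placed = map proj₁

unplaced : State → List Item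
unplaced = concatMap proj₂

private variable
  p q p′ q′ q″ : Bunch
  x : Item
  s t r : State

volume-contents : ∀ s → vol (items (contents s)) ≡ vol (items (placed s)) + sum (unplaced s)
volume-contents [] = refl
volume-contents ((p , q) ∷ s) = begin
  vol ((p ++ q) ++ items (contents s))
    ≡⟨ sum-++ (p ++ q) _ ⟩
  vol (p ++ q) + vol (items (contents s))
    ≡⟨ cong₂ _+_ (sum-++ p q) (volume-contents s) ⟩
  (vol p + vol q) + (vol (items (placed s)) + sum (unplaced s))
    ≡⟨ interchange (vol p) (vol q) _ _ ⟩
  (vol p + vol (items (placed s))) + (vol q + sum (unplaced s))
    ≡⟨ cong₂ _+_ (sum-++ p _) (sum-++ q _) ⟨
  vol (p ++ items (placed s)) + sum (q ++ unplaced s) ∎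
  where
  open ≡-Reasoning
  interchange : ∀ a b c d → (a + b) + (c + d) ≡ (a + c) + (b + d)
  interchange = solve-∀

unplaced-resp-↭ : s ↭ t → unplaced s ↭ unplaced t
unplaced-resp-↭ = concat-↭ ∘ map⁺ proj₂

∈-unplaced : ∀ s → x ∈ unplaced s → ∃[ p ] ∃[ q ] ∃[ r ] s ↭ (p , q) ∷ r × ∃[ q′ ] q ↭ x ∷ q′
∈-unplaced {x} ((p , q) ∷ s) x∈ with ∈-++⁻ q x∈
... | inj₁ x∈q with as , bs , refl ← ∈-∃++ x∈q = p , q , s , ↭-refl , as ++ bs , shift x as bs
... | inj₂ x∈s with p′ , q′ , r , s↭ , e ← ∈-unplaced s x∈s =
  p′ , q′ , (p , q) ∷ r , ↭-trans (↭-prep _ s↭) (↭-swap _ _ ↭-refl) , e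

-- Only unplaced items move.
record Step (κ : ℕ) (s t : State) : Set where
  constructor step
  field
    placed-↭   : placed s ↭ placed t
    unplaced-↭ : unplaced s ↭ unplaced t
    sequence   : ReconfigurationSequence κ (contents s) (contents t)

open Step

step-trans : Step κ s t → Step κ t r → Step κ s r
step-trans (step a b c) (step a′ b′ c′) = step (↭-trans a a′) (↭-trans b b′) (reconf-trans c c′)

-- First-fit on padded configurations.

Fits : ℕ → Item → Bunch → Set
Fits κ u B = vol B + u ℕ.≤ κ

fits⇒≤slack : ∀ {κ u} B → Fits κ u B → + u ℤ.≤ slack κ B
fits⇒≤slack {κ} {u} B fits = subst (+ u ℤ.≤_) (sym (ℤ.⊖-≥ (m+n≤o⇒m≤o (vol B) fits)))
  (+≤+ (m+n≤o⇒m≤o∸n u (subst (ℕ._≤ κ) (+-comm (vol B) u) fits)))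

≤slack⇒fits : ∀ {κ u} B → + u ℤ.≤ slack κ B → Fits κ u B
≤slack⇒fits {κ} {u} B le = ℤ.drop‿+≤+ (begin
  + (vol B + u)             ≤⟨ ℤ.+-monoʳ-≤ (+ vol B) le ⟩
  + vol B ℤ.+ (κ ⊖ vol B)   ≡⟨ ℤ.distribʳ-⊖-+-pos (vol B) κ (vol B) ⟩
  (vol B + κ) ⊖ vol B       ≡⟨ ℤ.⊖-≥ (m≤m+n (vol B) κ) ⟩
  + (vol B + κ ∸ vol B)   ≡⟨ cong +_ (m+n∸m≡n (vol B) κ) ⟩
  + κ                       ∎)
  where open ℤ.≤-Reasoning

-- That some bunch fits rules out the case in which `place` opens a new bunch. The bunch `B` found
-- is the first that fits, not necessarily the one witnessed.
place-first-fit : ∀ {κ u} P → Any (Fits κ u) P →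
  ∃[ as ] ∃[ B ] ∃[ bs ] P ≡ as ++ B ∷ bs × Fits κ u B × place κ P u ≡ as ++ (u ∷ B) ∷ bs
place-first-fit {κ} {u} (B ∷ P) any with + u ℤ.≤? slack κ B
... | yes le = [] , B , P , refl , ≤slack⇒fits B le , refl
place-first-fit {κ} {u} (B ∷ P) (here fits) | no ¬le = contradiction (fits⇒≤slack B fits) ¬le
place-first-fit {κ} {u} (B ∷ P) (there any) | no ¬le
  with as , B′ , bs , refl , fits , eq ← place-first-fit P any =
  B ∷ as , B′ , bs , refl , fits , cong (B ∷_) eq

padTo-∷ : ∀ n B C → padTo n (B ∷ C) ≡ B ∷ padTo (n ∸ 1) C
padTo-∷ zero B C = cong (λ k → B ∷ C ++ replicate k []) (sym (0∸n≡0 (length C)))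
padTo-∷ (suc n) B C = refl

-- An empty padding bunch stands for a bunch that first-fit has yet to open: filling the first of
-- them and opening a new bunch give the same padded configuration.
place-padTo : ∀ {κ u} n C → Any (Fits κ u) (padTo n C) →
              place κ (padTo n C) u ≡ padTo n (place κ C u)
place-padTo zero [] ()
place-padTo {κ} {u} (suc n) [] any with + u ℤ.≤? slack κ []
... | yes _ = refl
... | no ¬le = contradiction (fits⇒≤slack [] (fits-empty (suc n) any)) ¬le
  where
  fits-empty : ∀ n → Any (Fits κ u) (replicate n []) → Fits κ u []
  fits-empty (suc n) (here f) = f
  fits-empty (suc n) (there any) = fits-empty n any
place-padTo {κ} {u} n (B ∷ C) any =
  trans (cong (λ D → place κ D u) (padTo-∷ n B C))
        (place-∷ (subst (Any (Fits κ u)) (padTo-∷ n B C) any))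
  where
  place-∷ : Any (Fits κ u) (B ∷ padTo (n ∸ 1) C) →
            place κ (B ∷ padTo (n ∸ 1) C) u ≡ padTo n (place κ (B ∷ C) u)
  place-∷ any with + u ℤ.≤? slack κ B
  ... | yes _ = sym (padTo-∷ n (u ∷ B) C)
  place-∷ (here fits) | no ¬le = contradiction (fits⇒≤slack B fits) ¬le
  place-∷ (there any) | no ¬le =
    trans (cong (B ∷_) (place-padTo (n ∸ 1) C any)) (sym (padTo-∷ n B (place κ C u)))

contents-placed : ∀ s → unplaced s ≡ [] → contents s ≡ placed s
contents-placed [] _ = refl
contents-placed ((p , []) ∷ s) e = cong₂ _∷_ (++-identityʳ p) (contents-placed s e)

items-insert : ∀ {u B} as bs → items (as ++ (u ∷ B) ∷ bs) ↭ u ∷ items (as ++ B ∷ bs)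
items-insert [] bs = ↭-refl
items-insert {u} {B} (A ∷ as) bs =
  ↭-trans (++⁺ˡ A (items-insert as bs)) (shift u A (items (as ++ B ∷ bs)))

∈-placed : ∀ {B} s → B ∈ placed s → ∃[ q ] ∃[ r ] s ↭ (B , q) ∷ r
∈-placed ((p , q) ∷ s) (here refl) = q , s , ↭-refl
∈-placed ((p , q) ∷ s) (there i) =
  let q′ , r , e = ∈-placed s i
  in q′ , (p , q) ∷ r , ↭-trans (↭-prep _ e) (↭-swap _ _ ↭-refl)

-- The invariant and its preservation by steps.

module Reconfiguration (κ α : ℕ) .{{_ : NonZero κ}} .{{_ : NonZero α}} where

  -- `room` is the hypothesis on the average slack, cleared of denominators. The record depends only
  -- on the number of bunches and, up to permutation, on the placed and unplaced items, so every
  -- `Step` preserves it.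
  record Feasible (n : ℕ) (ps us : List Item) : Set where
    constructor feasible
    field
      room      : suc α * (sum ps + sum us) + 3 * (α * κ) ℕ.≤ n * (α * κ)
      bounded-p : All (Bounded κ α) ps
      bounded-u : All (Bounded κ α) us
      dominated : All (λ y → All (ℕ._≤ y) us) ps

  open Feasible

  feasible-resp-↭ : ∀ {n ps us ps′ us′} →
                    ps ↭ ps′ → us ↭ us′ → Feasible n ps us → Feasible n ps′ us′
  feasible-resp-↭ {n} e f (feasible a b c d) = feasible
    (subst₂ (λ v w → suc α * (v + w) + 3 * (α * κ) ℕ.≤ n * (α * κ)) (sum-↭ e) (sum-↭ f) a)
    (All-resp-↭ e b) (All-resp-↭ f c) (All.map (All-resp-↭ f) (All-resp-↭ e d))

  record Ready (s : State) : Set where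
    constructor ready
    field
      feas  : Feasible (length s) (items (placed s)) (unplaced s)
      legal : Legal κ (contents s)

  open Ready

  step-ready : Step κ s t → Ready s → Ready t
  step-ready {s} {t} (step a b c) (ready f l) = ready
    (subst (λ n → Feasible n (items (placed t)) (unplaced t))
           (trans (sym (length-map proj₁ s)) (trans (↭-length a) (length-map proj₁ t)))
           (feasible-resp-↭ (concat-↭ a) b f))
    (reconf-legalʳ c)

  -- Reordering bunches costs no move. It brings the bunches that take part in a move to the front,
  -- where `step-move` acts.
  step-↭ : Ready s → s ↭ t → Step κ s t
  step-↭ rdy e = step (map⁺ proj₁ e) (unplaced-resp-↭ e) (done (legal rdy) (↭⇒≈ (map⁺ _ e)))

  step-rearrange : Ready ((p , q) ∷ s) → q ↭ q′ → Step κ ((p , q) ∷ s) ((p , q′) ∷ s)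
  step-rearrange {p = p} rdy e = step ↭-refl (++⁺ʳ _ e) (done (legal rdy) (≈-prep (++⁺ˡ p e) ≈-refl))

  step-move : Ready ((p , q) ∷ (p′ , q′) ∷ s) → q ↭ x ∷ q″ → vol (p′ ++ q′) + x ℕ.≤ κ →
              Step κ ((p , q) ∷ (p′ , q′) ∷ s) ((p , q″) ∷ (p′ , x ∷ q′) ∷ s)
  step-move {p} {q} {p′} {q′} {s} {x} {q″} rdy e fits = step ↭-refl
    (↭-trans (++⁺ʳ _ e) (↭-sym (shift x q″ _)))
    (reconf-move (legal rdy)
      (subst (ℕ._≤ κ) (sym (trans (sum-↭ (shift x p′ q′)) (+-comm x _))) fits)
      (↭-trans (++⁺ˡ p e) (shift x p q″)) (shift x p′ q′))

  -- The spare `α * κ` is positive and so supplies the strict inequality of `pigeonhole`.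
  underfull-exists : ∀ C → suc α * vol (items C) + α * κ ℕ.≤ length C * (α * κ) →
                     Any (Underfull κ α) C
  underfull-exists C le = pigeonhole (suc α) (α * κ) C
    (<-≤-trans (m<m+n _ (ℕ.>-nonZero⁻¹ (α * κ))) le)
    where instance _ = m*n≢0 α κ

  underfull-resp-↭ : ∀ {B B′} → B ↭ B′ → Underfull κ α B → Underfull κ α B′
  underfull-resp-↭ e = subst (λ v → suc α * v ℕ.< α * κ) (sum-↭ e)

  -- The term 3ακ of the room inequality pays for two excluded bunches and
  -- leaves the strictness that the pigeonhole principle needs.
  find-underfull : ∀ E {R} → length E ℕ.≤ 2 → Ready (E ++ R) →
                   ∃[ p ] ∃[ q ] ∃[ r ] R ↭ (p , q) ∷ r × Underfull κ α (p ++ q)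
  find-underfull E {R} E≤2 (ready f _) = extract R (underfull-exists (contents R) enough)
    where
    extract : ∀ R → Any (Underfull κ α) (contents R) →
              ∃[ p ] ∃[ q ] ∃[ r ] R ↭ (p , q) ∷ r × Underfull κ α (p ++ q)
    extract ((p , q) ∷ R) (here u) = p , q , R , ↭-refl , u
    extract ((p , q) ∷ R) (there a) with p′ , q′ , r , e , u ← extract R a =
      p′ , q′ , (p , q) ∷ r , ↭-trans (↭-prep _ e) (↭-swap _ _ ↭-refl) , u
    open ≤-Reasoning
    vR≤ : vol (items (contents R)) ℕ.≤ sum (items (placed (E ++ R))) + sum (unplaced (E ++ R))
    vR≤ = begin
      vol (items (contents R))                                  ≤⟨ m≤n+m _ _ ⟩
      vol (items (contents E)) + vol (items (contents R))       ≡⟨ vol-++ E ⟩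
      vol (items (contents (E ++ R)))                           ≡⟨ volume-contents (E ++ R) ⟩
      sum (items (placed (E ++ R))) + sum (unplaced (E ++ R))   ∎
      where
      vol-++ : ∀ E → vol (items (contents E)) + vol (items (contents R)) ≡
                     vol (items (contents (E ++ R)))
      vol-++ [] = refl
      vol-++ ((p , q) ∷ E) = begin-equality
        vol ((p ++ q) ++ items (contents E)) + vol (items (contents R))
          ≡⟨ cong (_+ _) (sum-++ (p ++ q) _) ⟩
        (vol (p ++ q) + vol (items (contents E))) + vol (items (contents R))
          ≡⟨ +-assoc (vol (p ++ q)) _ _ ⟩
        vol (p ++ q) + (vol (items (contents E)) + vol (items (contents R)))
          ≡⟨ cong (_+_ (vol (p ++ q))) (vol-++ E) ⟩
        vol (p ++ q) + vol (items (contents (E ++ R)))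
          ≡⟨ sum-++ (p ++ q) _ ⟨
        vol ((p ++ q) ++ items (contents (E ++ R))) ∎
    enough : suc α * vol (items (contents R)) + α * κ ℕ.≤ length (contents R) * (α * κ)
    enough = +-cancelˡ-≤ (2 * (α * κ)) _ _ (begin
      2 * (α * κ) + (suc α * vol (items (contents R)) + α * κ)
        ≡⟨ collect (α * κ) (suc α * vol (items (contents R))) ⟩
      suc α * vol (items (contents R)) + 3 * (α * κ)
        ≤⟨ +-monoˡ-≤ (3 * (α * κ)) (*-monoʳ-≤ (suc α) vR≤) ⟩
      suc α * (sum (items (placed (E ++ R))) + sum (unplaced (E ++ R))) + 3 * (α * κ)
        ≤⟨ room f ⟩
      length (E ++ R) * (α * κ)
        ≡⟨ cong (_* (α * κ)) (length-++ E) ⟩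
      (length E + length R) * (α * κ)
        ≡⟨ *-distribʳ-+ (α * κ) (length E) (length R) ⟩
      length E * (α * κ) + length R * (α * κ)
        ≤⟨ +-mono-≤ (*-monoˡ-≤ (α * κ) E≤2) (≤-reflexive (cong (_* (α * κ)) (sym (length-map _ R)))) ⟩
      2 * (α * κ) + length (contents R) * (α * κ) ∎)
      where
      collect : ∀ a b → 2 * a + (b + a) ≡ b + 3 * a
      collect = solve-∀

  -- Evicting unplaced items from a bunch.

  -- `E` is to stay untouched. When a bunch is cleared to make way for a large item, `E` is the
  -- bunch of that item; together with the bunch being cleared this makes the two that
  -- `find-underfull` can exclude.
  evict-small : ∀ E {R} → length E ℕ.≤ 1 → Small κ α x → Ready ((p , x ∷ q) ∷ E ++ R) →
                ∃[ R′ ] Step κ ((p , x ∷ q) ∷ E ++ R) ((p , q) ∷ E ++ R′)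
  evict-small {x} {p} {q} E E≤1 small rdy
    with p′ , q′ , r , e , u ← find-underfull ((p , x ∷ q) ∷ E) (s≤s E≤1) rdy =
    (p′ , x ∷ q′) ∷ r , step-trans s₁ (step-trans s₂ s₃)
    where
    s₁ : Step κ ((p , x ∷ q) ∷ E ++ _) ((p , x ∷ q) ∷ (p′ , q′) ∷ E ++ r)
    s₁ = step-↭ rdy (↭-prep _ (↭-trans (++⁺ˡ E e) (shift _ E r)))
    rdy₁ : Ready ((p , x ∷ q) ∷ (p′ , q′) ∷ E ++ r)
    rdy₁ = step-ready s₁ rdy
    s₂ : Step κ ((p , x ∷ q) ∷ (p′ , q′) ∷ E ++ r) ((p , q) ∷ (p′ , x ∷ q′) ∷ E ++ r)
    s₂ = step-move rdy₁ ↭-refl (small-fits κ α {p′ ++ q′} u small)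
    s₃ : Step κ ((p , q) ∷ (p′ , x ∷ q′) ∷ E ++ r) ((p , q) ∷ E ++ (p′ , x ∷ q′) ∷ r)
    s₃ = step-↭ (step-ready s₂ rdy₁) (↭-prep _ (↭-sym (shift _ E r)))

  evict-smalls : ∀ E {R} xs → length E ℕ.≤ 1 → All (Small κ α) xs →
                 Ready ((p , xs ++ q) ∷ E ++ R) →
                 ∃[ R′ ] Step κ ((p , xs ++ q) ∷ E ++ R) ((p , q) ∷ E ++ R′)
  evict-smalls E {R} [] _ _ rdy = R , step-↭ rdy ↭-refl
  evict-smalls {p} {q} E (x ∷ xs) E≤1 (small ∷ smalls) rdy =
    let R₁ , s₁ = evict-small {q = xs ++ q} E E≤1 small rdy
        R′ , s₂ = evict-smalls {p} {q} E {R₁} xs E≤1 smalls (step-ready s₁ rdy)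
    in R′ , step-trans s₁ s₂

  evict : ∀ {R} → Ready ((p , x ∷ q) ∷ R) → ∃[ R′ ] Step κ ((p , x ∷ q) ∷ R) ((p , q) ∷ R′)
  evict {p} {x} {q} rdy with suc α * x ≤? κ
  ... | yes small = evict-small [] z≤n small rdy
  ... | no ¬small =
    let p′ , q′ , r , e , u = find-underfull ((p , x ∷ q) ∷ []) (s≤s z≤n) rdy
        smalls , larges = partition small? q′
        all-small , all-large = partition-All small? q′
        q′↭ = ↭ₛ⇒↭ (SetoidProperties.partition-↭ (setoid Item) small? q′)
        s₁ = step-↭ {t = (p′ , q′) ∷ (p , x ∷ q) ∷ r} rdy (↭-trans (↭-prep _ e) (↭-swap _ _ ↭-refl))
        rdy₁ = step-ready s₁ rdy
        s₂ = step-rearrange rdy₁ q′↭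
        rdy₂ = step-ready s₂ rdy₁
        R′ , s₃ = evict-smalls {p′} {larges} ((p , x ∷ q) ∷ []) {r} smalls (s≤s z≤n) all-small rdy₂
        rdy₃ = step-ready s₃ rdy₂
        -- With its bunch in front, `x` heads the list of unplaced items, so `fits` can obtain its
        -- bounds by matching on `feas rdy₄`.
        s₄ = step-↭ {t = (p , x ∷ q) ∷ (p′ , larges) ∷ R′} rdy₃ (↭-swap _ _ ↭-refl)
        rdy₄ = step-ready s₄ rdy₃
        s₅ = step-move rdy₄ ↭-refl
               (fits p′ smalls larges (underfull-resp-↭ (++⁺ˡ p′ q′↭) u) all-large (feas rdy₄))
    in (p′ , x ∷ larges) ∷ R′ , step-trans s₁ (step-trans s₂ (step-trans s₃ (step-trans s₄ s₅)))
    where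
    small? = λ y → suc α * y ≤? κ
    fits : ∀ {n P U} p′ smalls larges →
           Underfull κ α (p′ ++ smalls ++ larges) → All (λ y → suc α * y ℕ.≰ κ) larges →
           Feasible n (p ++ p′ ++ P) ((x ∷ q) ++ larges ++ U) → vol (p′ ++ larges) + x ℕ.≤ κ
    fits p′ smalls larges u all-large (feasible _ bp (bx ∷ bu) dom) =
      bounded-fits κ α {p′ ++ larges}
      -- Losing its small items only lowers the volume, so the bunch is still underfull.
      (≤-<-trans (*-monoʳ-≤ (suc α) (begin
        vol (p′ ++ larges)               ≤⟨ m≤n+m _ (vol smalls) ⟩
        vol smalls + vol (p′ ++ larges)  ≡⟨ sum-++ smalls (p′ ++ larges) ⟨
        vol (smalls ++ p′ ++ larges)     ≡⟨ sum-↭ (shifts smalls p′) ⟩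
        vol (p′ ++ smalls ++ larges)     ∎)) u)
      -- The placed items of `p′` are at least as large as the unplaced `x`, hence large as well.
      (All-++⁺ (All.map (λ { (x≤y ∷ _) → <-≤-trans (≰⇒> ¬small) (*-monoʳ-≤ (suc α) x≤y) })
                        (++⁻ˡ p′ (++⁻ʳ p dom)))
               (All.map ≰⇒> all-large))
      (All-++⁺ (++⁻ˡ p′ (++⁻ʳ p bp)) (++⁻ˡ larges (++⁻ʳ q bu))) bx
      where open ≤-Reasoning

  evict-all : ∀ q {R} → Ready ((p , q) ∷ R) → ∃[ R′ ] Step κ ((p , q) ∷ R) ((p , []) ∷ R′)
  evict-all [] {R} rdy = R , step-↭ rdy ↭-refl
  evict-all {p} (x ∷ q) rdy =
    let R₁ , s₁ = evict rdy
        R′ , s₂ = evict-all {p} q {R₁} (step-ready s₁ rdy)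
    in R′ , step-trans s₁ s₂

  -- Bringing the items to their first-fit positions.

  place-item : ∀ {u} {R} → Ready ((p , q) ∷ R) → u ∈ unplaced ((p , q) ∷ R) → vol p + u ℕ.≤ κ →
               ∃[ t ] placed t ↭ (u ∷ p) ∷ placed R × unplaced ((p , q) ∷ R) ↭ u ∷ unplaced t ×
                      ReconfigurationSequence κ (contents ((p , q) ∷ R)) (contents t)
  place-item {p} {q} {u} {R} rdy u∈ fits =
    -- If `u` itself lies in this bunch it is evicted too, so that afterwards it always arrives from
    -- another bunch.
    let R′ , s₁ = evict-all q rdy
        p′ , q′ , r , R′↭ , q″ , q′↭ = ∈-unplaced R′ (∈-resp-↭ (unplaced-↭ s₁) u∈)
        rdy₁ = step-ready s₁ rdy
        s₂ = step-↭ {t = (p′ , q′) ∷ (p , []) ∷ r} rdy₁ (↭-trans (↭-prep _ R′↭) (↭-swap _ _ ↭-refl))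
        s₃ = step-trans s₁ s₂
    in (p′ , q″) ∷ (u ∷ p , []) ∷ r ,
       ↭-trans (↭-swap _ _ ↭-refl)
               (↭-prep _ (drop-∷ (↭-trans (↭-swap _ _ ↭-refl) (↭-sym (placed-↭ s₃))))) ,
       ↭-trans (unplaced-↭ s₃) (++⁺ʳ _ q′↭) ,
       reconf-trans (sequence s₃)
         (reconf-move (legal (step-ready s₂ rdy₁))
           (subst (ℕ._≤ κ) (trans (+-comm (vol p) u) (cong (λ B → u + vol B) (sym (++-identityʳ p))))
             fits)
           (↭-trans (++⁺ˡ p′ q′↭) (shift u p′ q″)) ↭-refl)

  -- The count is applied to the placed items alone, with no bunch excluded. All of them are at
  -- least as large as `u`, so if `u` is large, the underfull bunch found holds large items only.
  fits-exists : ∀ {u us} P → Feasible (length P) (items P) (u ∷ us) → Any (Fits κ u) P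
  fits-exists {u} {us} P (feasible room bp (bu ∷ _) dom) = lose (proj₁ (proj₂ found)) fits
    where
    open ≤-Reasoning
    found : ∃[ B ] B ∈ P × Underfull κ α B
    found = find (underfull-exists P (begin
      suc α * vol (items P) + α * κ
        ≤⟨ +-mono-≤ (*-monoʳ-≤ (suc α) (m≤m+n (vol (items P)) (sum (u ∷ us)))) (m≤n*m (α * κ) 3) ⟩
      suc α * (vol (items P) + sum (u ∷ us)) + 3 * (α * κ)
        ≤⟨ room ⟩
      length P * (α * κ) ∎))
    B = proj₁ found
    fits : Fits κ u B
    fits with suc α * u ≤? κ
    ... | yes small = small-fits κ α {B} (proj₂ (proj₂ found)) small
    ... | no ¬small = bounded-fits κ α {B} (proj₂ (proj₂ found))
      (All.map (λ { (u≤y ∷ _) → <-≤-trans (≰⇒> ¬small) (*-monoʳ-≤ (suc α) u≤y) })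
               (All.lookup (concat⁻ dom) (proj₁ (proj₂ found))))
      (All.lookup (concat⁻ bp) (proj₁ (proj₂ found))) bu

  -- The total in `room` does not change, and `dominated` survives because items are placed in
  -- non-increasing order.
  feasible-place : ∀ {n ps ps′ u us} → All (ℕ._≤ u) us → ps′ ↭ u ∷ ps →
                   Feasible n ps (u ∷ us) → Feasible n ps′ us
  feasible-place {n} {ps} {ps′} {u} {us} u≥ e (feasible room bp (bu ∷ bus) dom) =
    feasible-resp-↭ (↭-sym e) ↭-refl (feasible
      (subst (λ v → suc α * v + 3 * (α * κ) ℕ.≤ n * (α * κ)) (move-summand (sum ps) u (sum us)) room)
      (bu ∷ bp) bus (u≥ ∷ All.map All.tail dom))
    where
    move-summand : ∀ a b c → a + (b + c) ≡ (b + a) + c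
    move-summand = solve-∀

  -- First-fit depends on the order of the bunches, which `s` does not keep. Hence `C` is carried
  -- along in order, unpadded as `foldl` builds it, and the placed parts of `s` match its padding up
  -- to a permutation.
  pack : ∀ n us C s → AllPairs ℕ._≥_ us → Feasible (length (padTo n C)) (items (padTo n C)) us →
         placed s ↭ padTo n C → unplaced s ↭ us → Legal κ (contents s) →
         ReconfigurationSequence κ (contents s) (padTo n (foldl (place κ) C us))
  pack n [] C s _ _ ps us l =
    done l (↭⇒≈ (↭-trans (↭-reflexive (contents-placed s (↭-empty-inv us))) ps))
  pack n (u ∷ us) C s (u≥ ∷ sorted) feas ps↭ us↭ l
    with any ← fits-exists (padTo n C) feas
    with as , B , bs , split , fits , place≡ ← place-first-fit {κ} {u} (padTo n C) any
    with padded ← trans (sym (place-padTo n C any)) place≡ =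
    let D↭ = ↭-trans (↭-reflexive split) (shift B as bs)
        q , r , s↭ = ∈-placed s (∈-resp-↭ (↭-sym (↭-trans ps↭ D↭)) (here refl))
        s₁ = step-↭ start s↭
        placed-r : placed r ↭ as ++ bs
        placed-r = drop-∷ (↭-trans (↭-sym (placed-↭ s₁)) (↭-trans ps↭ D↭))
        t , placed-t , unplaced-t , seq = place-item {u = u} (step-ready s₁ start)
          (∈-resp-↭ (↭-trans (↭-sym us↭) (unplaced-↭ s₁)) (here refl)) fits
    in reconf-trans (sequence s₁) (reconf-trans seq
         (pack n us (place κ C u) t sorted
           (subst (λ D → Feasible (length D) (items D) us) (sym padded)
             (feasible-place u≥ (items-insert as bs)
               (subst (λ k → Feasible k (items (as ++ B ∷ bs)) (u ∷ us)) (length-insert as)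
                 (subst (λ D → Feasible (length D) (items D) (u ∷ us)) split feas))))
           (↭-trans placed-t (↭-trans (↭-prep _ placed-r)
             (↭-trans (↭-sym (shift (u ∷ B) as bs)) (↭-reflexive (sym padded)))))
           (drop-∷ (↭-trans (↭-sym unplaced-t) (↭-trans (↭-sym (unplaced-↭ s₁)) us↭)))
           (reconf-legalʳ seq)))
    where
    start : Ready s
    start = ready (subst (λ k → Feasible k (items (placed s)) (unplaced s))
                         (trans (sym (↭-length ps↭)) (length-map proj₁ s))
                         (feasible-resp-↭ (concat-↭ (↭-sym ps↭)) (↭-sym us↭) feas)) l
    length-insert : ∀ as {bs : Config} {B B′} → length (as ++ B ∷ bs) ≡ length (as ++ B′ ∷ bs)
    length-insert as = trans (length-++ as) (sym (length-++ as))

-- The order behind `sortNonIncreasing`; the module below supplies the proofs that the result is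
-- sorted and a permutation.
≥-decTotalOrder = Flip.decTotalOrder ≤-decTotalOrder
module NonIncreasing = Sort ≥-decTotalOrder

-- From the average slack to an inequality of natural numbers.

total-slack : ∀ κ C → foldr ℤ._+_ ℤ.0ℤ (map (slack κ) C) ℤ.+ + vol (items C) ≡ + (length C * κ)
total-slack κ [] = refl
total-slack κ (B ∷ C) = begin
  (κ ⊖ vol B) ℤ.+ S ℤ.+ + vol (B ++ items C)
    ≡⟨ cong₂ (λ i j → i ℤ.+ S ℤ.+ j) (ℤ.m-n≡m⊖n κ (vol B))
         (trans (sym (ℤ.pos-+ (vol B) _)) (cong +_ (sym (sum-++ B (items C))))) ⟨
  (+ κ ℤ.- + vol B) ℤ.+ S ℤ.+ (+ vol B ℤ.+ + vol (items C))
    ≡⟨ cancel (+ κ) (+ vol B) S (+ vol (items C)) ⟩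
  + κ ℤ.+ (S ℤ.+ + vol (items C))
    ≡⟨ cong (ℤ._+_ (+ κ)) (total-slack κ C) ⟩
  + κ ℤ.+ + (length C * κ)
    ≡⟨ ℤ.pos-+ κ (length C * κ) ⟨
  + (κ + length C * κ) ∎
  where
  open ≡-Reasoning
  S = foldr ℤ._+_ ℤ.0ℤ (map (slack κ) C)
  cancel : ∀ k b s v → (k ℤ.- b) ℤ.+ s ℤ.+ (b ℤ.+ v) ≡ k ℤ.+ (s ℤ.+ v)
  cancel = ℤSolver.solve-∀

-- `_/_` reduces fractions to lowest terms, so the comparison passes to unnormalised rationals,
-- where numerator and denominator stay as given.
≤-cross : ∀ i m j n → (i / suc m) ≤ (j / suc n) → i ℤ.* + suc n ℤ.≤ j ℤ.* + suc m
≤-cross i m j n le = ℚᵘ.drop-*≤* (begin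
  ℚᵘ.mkℚᵘ i m             ≃⟨ ℚ.toℚᵘ-fromℚᵘ (ℚᵘ.mkℚᵘ i m) ⟨
  ℚ.toℚᵘ (i / suc m)      ≤⟨ ℚ.toℚᵘ-mono-≤ le ⟩
  ℚ.toℚᵘ (j / suc n)      ≃⟨ ℚ.toℚᵘ-fromℚᵘ (ℚᵘ.mkℚᵘ j n) ⟩
  ℚᵘ.mkℚᵘ j n             ∎)
  where open ℚᵘ.≤-Reasoning

bounded-from-≤ : ∀ {κ u} α .{{_ : NonZero α}} → (+ u / 1) ≤ (+ κ / α) → α * u ℕ.≤ κ
bounded-from-≤ {κ} {u} (suc α) le = ℤ.drop‿+≤+ (subst₂ ℤ._≤_
  (trans (ℤ.*-comm (+ u) (+ suc α)) (sym (ℤ.pos-* (suc α) u))) (ℤ.*-identityʳ (+ κ))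
  (≤-cross (+ u) 0 (+ κ) α le))

slackBound-cross : ∀ κ α n s → slackBound κ α (suc n) ≤ s / suc n →
  (+ κ ℤ.* + (suc α * suc n) ℤ.+ + (3 * α * κ) ℤ.* + suc α) ℤ.* + suc n ℤ.≤
  s ℤ.* + (suc α * (suc α * suc n))
slackBound-cross κ α n s le = ℚᵘ.drop-*≤* (begin
  k ℚᵘ.+ c
    ≃⟨ ℚᵘ.+-cong (ℚ.toℚᵘ-fromℚᵘ k) (ℚ.toℚᵘ-fromℚᵘ c) ⟨
  ℚ.toℚᵘ (ℚ.fromℚᵘ k) ℚᵘ.+ ℚ.toℚᵘ (ℚ.fromℚᵘ c)
    ≃⟨ ℚ.toℚᵘ-homo-+ (ℚ.fromℚᵘ k) (ℚ.fromℚᵘ c) ⟨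
  ℚ.toℚᵘ (slackBound κ α (suc n))
    ≤⟨ ℚ.toℚᵘ-mono-≤ le ⟩
  ℚ.toℚᵘ (s / suc n)
    ≃⟨ ℚ.toℚᵘ-fromℚᵘ (ℚᵘ.mkℚᵘ s n) ⟩
  ℚᵘ.mkℚᵘ s n ∎)
  where
  open ℚᵘ.≤-Reasoning
  k = ℚᵘ.mkℚᵘ (+ κ) α
  -- `mkℚᵘ` stores the denominator minus one, and `suc α * suc n` is `suc (n + α * suc n)`.
  c = ℚᵘ.mkℚᵘ (+ (3 * α * κ)) (n + α * suc n)

-- With `S` the total slack, clearing denominators gives `κ * n + 3 * α * κ ≤ S * suc α`. Adding
-- `V * suc α` turns the right side into `n * κ * suc α` by `total-slack`, and `n * κ` cancels.
room-from-average : ∀ κ α C .{{_ : NonZero (length C)}} →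
                    slackBound κ α (length C) ≤ averageSlack κ C →
                    suc α * vol (items C) + 3 * (α * κ) ℕ.≤ length C * (α * κ)
room-from-average κ α C@(_ ∷ C′) le = +-cancelʳ-≤ (n * κ) _ _ (ℤ.drop‿+≤+ (begin
  + (suc α * V + 3 * (α * κ) + n * κ)
    ≡⟨ cong +_ (reorder α V κ n) ⟩
  + (κ * n + 3 * α * κ + V * suc α)
    ≡⟨ trans (ℤ.pos-+ (κ * n + 3 * α * κ) _)
         (cong (ℤ._+_ (+ (κ * n + 3 * α * κ))) (ℤ.pos-* V (suc α))) ⟩
  + (κ * n + 3 * α * κ) ℤ.+ + V ℤ.* + suc α
    ≤⟨ ℤ.+-monoˡ-≤ (+ V ℤ.* + suc α) cleared ⟩
  S ℤ.* + suc α ℤ.+ + V ℤ.* + suc α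
    ≡⟨ ℤ.*-distribʳ-+ (+ suc α) S (+ V) ⟨
  (S ℤ.+ + V) ℤ.* + suc α
    ≡⟨ cong (ℤ._* + suc α) (total-slack κ C) ⟩
  + (n * κ) ℤ.* + suc α
    ≡⟨ ℤ.pos-* (n * κ) (suc α) ⟨
  + (n * κ * suc α)
    ≡⟨ cong +_ (expand n κ α) ⟩
  + (n * (α * κ) + n * κ) ∎))
  where
  open ℤ.≤-Reasoning
  n = length C
  V = vol (items C)
  S = foldr ℤ._+_ ℤ.0ℤ (map (slack κ) C)
  reorder : ∀ α V κ n → suc α * V + 3 * (α * κ) + n * κ ≡ κ * n + 3 * α * κ + V * suc α
  reorder = solve-∀
  expand : ∀ n κ α → n * κ * suc α ≡ n * (α * κ) + n * κ
  expand = solve-∀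
  factor : ∀ k a n c → (k ℤ.* (a ℤ.* n) ℤ.+ c ℤ.* a) ℤ.* n ≡ (k ℤ.* n ℤ.+ c) ℤ.* (a ℤ.* n)
  factor = ℤSolver.solve-∀
  unfactor : ∀ s a n → s ℤ.* (a ℤ.* (a ℤ.* n)) ≡ (s ℤ.* a) ℤ.* (a ℤ.* n)
  unfactor = ℤSolver.solve-∀
  cleared : + (κ * n + 3 * α * κ) ℤ.≤ S ℤ.* + suc α
  -- The unnormalised sum in `slackBound` has the product of both denominators below it, so a common
  -- factor `suc α * n` remains to be cancelled.
  cleared = ℤ.*-cancelʳ-≤-pos _ _ (+ (suc α * n)) (begin
    + (κ * n + 3 * α * κ) ℤ.* + (suc α * n)
      ≡⟨ cong (ℤ._* + (suc α * n))
           (trans (ℤ.pos-+ (κ * n) _) (cong (ℤ._+ + (3 * α * κ)) (ℤ.pos-* κ n))) ⟩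
    (+ κ ℤ.* + n ℤ.+ + (3 * α * κ)) ℤ.* (+ suc α ℤ.* + n)
      ≡⟨ factor (+ κ) (+ suc α) (+ n) (+ (3 * α * κ)) ⟨
    (+ κ ℤ.* + (suc α * n) ℤ.+ + (3 * α * κ) ℤ.* + suc α) ℤ.* + n
      ≤⟨ slackBound-cross κ α (length C′) S le ⟩
    S ℤ.* + (suc α * (suc α * n))
      ≡⟨ cong (ℤ._*_ S) (ℤ.pos-* (suc α) (suc α * n)) ⟩
    S ℤ.* (+ suc α ℤ.* (+ suc α ℤ.* + n))
      ≡⟨ unfactor S (+ suc α) (+ n) ⟩
    (S ℤ.* + suc α) ℤ.* + (suc α * n) ∎)

-- The initial state and the theorem.

contents-unplaced : ∀ C → contents (map ([] ,_) C) ≡ C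
contents-unplaced C = trans (sym (map-∘ C)) (map-id C)

placed-unplaced : ∀ C → placed (map ([] ,_) C) ≡ replicate (length C) []
placed-unplaced [] = refl
placed-unplaced (_ ∷ C) = cong ([] ∷_) (placed-unplaced C)

unplaced-unplaced : ∀ C → unplaced (map ([] ,_) C) ≡ items C
unplaced-unplaced [] = refl
unplaced-unplaced (B ∷ C) = cong (B ++_) (unplaced-unplaced C)

items-replicate : ∀ n → items (replicate n []) ≡ []
items-replicate zero = refl
items-replicate (suc n) = items-replicate n

-- Initially every item is unplaced and the placed parts are empty bunches, that is, `padTo n []`,
-- where first-fit starts. The conditions on placed items then hold vacuously.
reconf-FFD : ∀ {κ α U} C .{{_ : NonZero κ}} .{{_ : NonZero α}} .{{_ : NonZero (length C)}} →
             Legal κ C → items C ↭ U → All (Bounded κ α) U →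
             slackBound κ α (length C) ≤ averageSlack κ C →
             ReconfigurationSequence κ C (FFD κ (length C) U)
reconf-FFD {κ} {α} {U} C legal C↭U bounded slack≥ =
  subst (λ D → ReconfigurationSequence κ D (FFD κ n U)) (contents-unplaced C)
    (pack n us [] (map ([] ,_) C)
      (Sorted⇒AllPairs (DecTotalOrder.totalOrder ≥-decTotalOrder) (NonIncreasing.sort-↗ U))
      (feasible
        (subst₂ (λ m ps → suc α * (sum ps + sum us) + 3 * (α * κ) ℕ.≤ m * (α * κ))
          (sym (length-replicate n)) (sym (items-replicate n))
          (subst (λ v → suc α * v + 3 * (α * κ) ℕ.≤ n * (α * κ)) (sum-↭ C↭us)
            (room-from-average κ α C slack≥)))
        (subst (All (Bounded κ α)) (sym (items-replicate n)) [])
        (All-resp-↭ (↭-sym (NonIncreasing.sort-↭ U)) bounded)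
        (subst (All (λ y → All (ℕ._≤ y) us)) (sym (items-replicate n)) []))
      (↭-reflexive (placed-unplaced C))
      (↭-trans (↭-reflexive (unplaced-unplaced C)) C↭us)
      (subst (Legal κ) (sym (contents-unplaced C)) legal))
  where
  open Reconfiguration κ α
  n = length C
  us = sortNonIncreasing U
  C↭us : items C ↭ us
  C↭us = ↭-trans C↭U (↭-sym (NonIncreasing.sort-↭ U))

theorem5 : (κ : ℕ) → 0 < κ →
    (CS CT : Config) .{{_ : NonZero (length CS)}} .{{_ : NonZero (length CT)}} →
    (U : List Item) → All (λ u → 0 < u) U →
    Legal κ CS → Legal κ CT →
    length CS ≡ length CT →
    items CS ↭ U → items CT ↭ U →
    (α : ℕ) .{{_ : NonZero α}} → 1 < α →
    All (λ u → + u / 1 ≤ + κ / α) U →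
    slackBound κ α (length CS) ≤ averageSlack κ CS →
    slackBound κ α (length CS) ≤ averageSlack κ CT →
    ReconfigurationSequence κ CS (FFD κ (length CS) U) ×
    ReconfigurationSequence κ CT (FFD κ (length CS) U) ×
    ReconfigurationSequence κ CS CT
theorem5 κ 0<κ CS CT U _ legalS legalT |CS|≡|CT| CS↭U CT↭U α _ u≤κ/α slackS slackT =
  S⇒FFD , T⇒FFD , reconf-trans S⇒FFD (reconf-sym T⇒FFD)
  where
  instance _ = ℕ.>-nonZero 0<κ
  bounded : All (Bounded κ α) U
  bounded = All.map (bounded-from-≤ α) u≤κ/α
  -- Plain `cong` does not apply, as `slackBound` also takes a `NonZero` instance for the length.
  -- The instance is irrelevant, so matching on `refl` is enough.
  slackBound-cong : ∀ {m n} .{{_ : NonZero m}} .{{_ : NonZero n}} → m ≡ n →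
                    slackBound κ α m ≡ slackBound κ α n
  slackBound-cong refl = refl
  S⇒FFD : ReconfigurationSequence κ CS (FFD κ (length CS) U)
  S⇒FFD = reconf-FFD CS legalS CS↭U bounded slackS
  T⇒FFD : ReconfigurationSequence κ CT (FFD κ (length CS) U)
  T⇒FFD = subst (λ n → ReconfigurationSequence κ CT (FFD κ n U)) (sym |CS|≡|CT|)
    (reconf-FFD CT legalT CT↭U bounded
      (subst (_≤ averageSlack κ CT) (slackBound-cong |CS|≡|CT|) slackT))
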